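{- Let $\mathcal{R}$ be a term rewrite system such that all innermost critical overlays of $\mathcal{R}$ are trivial. Then the parallel-innermost rewrite relation $\Rightarrow_{\mathcal{R}}$ is deterministic and hence confluent.
   Context: Terms and rewriting. $\mathcal{T}(\Sigma,\mathcal{V})$ is the set of first-order terms over a finite signature $\Sigma$ and variables $\mathcal{V}$. $t|_\pi$ is the subterm of $t$ at position $\pi$ ($\varepsilon$ is the root position), $t[s]_\pi$ is $t$ with that subterm replaced by $s$. A term rewrite system (TRS) $\mathcal{R}$ is a finite set of rules $\ell \to r$ with $\ell,r$ terms, $\ell \notin \mathcal{V}$ and $\mathcal{V}(r) \subseteq \mathcal{V}(\ell)$ (where $\mathcal{V}(t)$ is the set of variables of $t$). $s \to_{\mathcal{R}} t$ iff $s|_\pi = \ell\sigma$ and $t = s[r\sigma]_\pi$ for some $\ell\to r\in\mathcal{R}$, position $\pi$ of $s$ and substitution $\sigma$; $\ell\sigma$ is the redex. It is an innermost redex if no proper subterm of it is a redex, and then the step is an innermost step, written $s \xrightarrow{\mathsf{i}}_{\mathcal{R}} t$. Parallel-innermost rewriting $\Rightarrow_{\mathcal{R}}$ (all innermost redexes are rewritten simultaneously): $s \Rightarrow_{\mathcal{R}} t$ iff $s \xrightarrow{\mathsf{i}}{}^{+}_{\mathcal{R}} t$ and either (a) $s \xrightarrow{\mathsf{i}}_{\mathcal{R}} t$ with $s$ an innermost redex, or (b) $s=f(s_1,\ldots,s_n)$, $t=f(t_1,\ldots,t_n)$, and for all $1\le k\le n$ either $s_k\Rightarrow_{\mathcal{R}}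 t_k$ or $s_k=t_k$ is a normal form. A relation $\to$ is deterministic iff for every $s$ there is at most one $t$ with $s\to t$; it is confluent iff $s\to^* t$ and $s\to^* u$ imply there is $v$ with $t\to^* v$ and $u\to^* v$. Critical pairs: let $\ell\to r,\ u\to v\in\mathcal{R}$ be rules whose variables have been renamed apart and let $\pi$ be a position in $u$ such that $u|_\pi\notin\mathcal{V}$. If $\pi=\varepsilon$, it is required that $\ell\to r$ and $u\to v$ are not variants of the same rule (i.e., are not equal up to renaming of variables). If $\ell$ and $u|_\pi$ unify with most general unifier $\sigma$, then the pair of terms $u\sigma[r\sigma]_\pi\rtimes v\sigma$ is a critical pair, resulting from the critical peak given by the steps $u\sigma\to_{\mathcal{R}}v\sigma$ and $u\sigma=u\sigma[\ell\sigma]_\pi\to_{\mathcal{R}}u\sigma[r\sigma]_\pi$. If $\pi=\varepsilon$, the critical pair is called a critical overlay, written $r\sigma\Join v\sigma$. A critical pair is trivial if its two components are the same term. A critical overlay $s\Join t$ resulting from a critical peak $\ell\sigma=u\sigma\to_{\mathcal{R}}s$ and $\ell\sigma=u\sigma\to_{\mathcal{R}}t$ is called innermost for $\mathcal{R}$ iff also $\ell\sigma=u\sigma\xrightarrow{\mathsf{i}}_{\mathcal{R}}s$ and $\ell\sigma=u\sigma\xrightarrow{\mathsf{i}}_{\mathcal{R}}t$.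
   Formalization: Clause (b) of ⇒ additionally requires that s is not itself an innermost redex; without this the claim fails for {a → b, b → a}, where a ⇒ b by (a) and a ⇒ a by (b). Only steps s ⇒ s from an innermost redex s, and steps built on them, are removed. -}

module Defs where

open import Data.Empty using (⊥)
open import Data.Fin using (Fin)
open import Data.List using (List)
open import Data.List.Membership.Propositional using (_∈_)
open import Data.Nat using (ℕ)
open import Data.Product using (Σ; ∃; _×_)
open import Data.Sum using (_⊎_)
open import Data.Unit using (⊤)
open import Data.Vec using (Vec; []; _∷_)
open import Data.Vec.Relation.Binary.Pointwise.Inductive using (Pointwise)
open import Data.Vec.Relation.Unary.Any using (Any; here; there)
open import Function.Bundles using (_↔_; Inverse)
open import Relation.Binary.Construct.Closure.Transitive using (TransClosure)
open import Relation.Binary.PropositionalEquality using (_≡_; _≢_)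
open import Relation.Binary.Rewriting using (IsNormalForm)
open import Relation.Nullary using (¬_)

record Signature : Set where
  field
    size  : ℕ
    arity : Fin size → ℕ

  Symbol : Set
  Symbol = Fin size

open Signature public

-- The countably infinite set of variables is ℕ.
data Term (S : Signature) : Set where
  var : ℕ → Term S
  fun : (f : Symbol S) → Vec (Term S) (arity S f) → Term S

module _ {S : Signature} where

  IsVar : Term S → Set
  IsVar (var _)   = ⊤
  IsVar (fun _ _) = ⊥

  data _occursIn_ (x : ℕ) : Term S → Set where
    here : x occursIn var x
    arg  : ∀ {f ts} → Any (x occursIn_) ts → x occursIn fun f ts

  -- The positions of a given term: a position other than the root ε selects
  -- one of the arguments and a position in that argument.
  data Pos : Term S → Set where
    ε   : ∀ {t} → Pos t
    arg : ∀ {f ts} → Any Pos ts → Pos (fun f ts)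

  infix 8 _∣_ _∣ₐ_

  mutual
    _∣_ : (t : Term S) → Pos t → Term S
    t        ∣ ε     = t
    fun f ts ∣ arg π = ts ∣ₐ π

    _∣ₐ_ : ∀ {n} (ts : Vec (Term S) n) → Any Pos ts → Term S
    (t ∷ ts) ∣ₐ here π  = t ∣ π
    (t ∷ ts) ∣ₐ there π = ts ∣ₐ π

  infix 8 _[_]at_ _[_]atₐ_

  mutual
    _[_]at_ : (t : Term S) → Term S → Pos t → Term S
    t        [ s ]at ε     = s
    fun f ts [ s ]at arg π = fun f (ts [ s ]atₐ π)

    _[_]atₐ_ : ∀ {n} (ts : Vec (Term S) n) → Term S → Any Pos ts → Vec (Term S) n
    (t ∷ ts) [ s ]atₐ here π  = (t [ s ]at π) ∷ ts
    (t ∷ ts) [ s ]atₐ there π = t ∷ (ts [ s ]atₐ π)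

-- Domains need not be finite.
Subst : Signature → Set
Subst S = ℕ → Term S

module _ {S : Signature} where

  infixl 9 _·_ _·ₐ_

  mutual
    _·_ : Term S → Subst S → Term S
    var x    · σ = σ x
    fun f ts · σ = fun f (ts ·ₐ σ)

    _·ₐ_ : ∀ {n} → Vec (Term S) n → Subst S → Vec (Term S) n
    []       ·ₐ σ = []
    (t ∷ ts) ·ₐ σ = (t · σ) ∷ (ts ·ₐ σ)

  -- A position of t, regarded as a position of t · σ.
  mutual
    liftPos : (σ : Subst S) {t : Term S} → Pos t → Pos (t · σ)
    liftPos σ ε       = ε
    liftPos σ (arg π) = arg (liftPosₐ σ π)

    liftPosₐ : (σ : Subst S) {n : ℕ} {ts : Vec (Term S) n} → Any Pos ts → Any Pos (ts ·ₐ σ)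
    liftPosₐ σ (here π)  = here (liftPos σ π)
    liftPosₐ σ (there π) = there (liftPosₐ σ π)

  Unifies : Subst S → Term S → Term S → Set
  Unifies σ s t = s · σ ≡ t · σ

  IsMGU : Subst S → Term S → Term S → Set
  IsMGU σ s t =
    Unifies σ s t ×
    (∀ τ → Unifies τ s t → ∃ λ (δ : Subst S) → ∀ x → τ x ≡ σ x · δ)

record Rule (S : Signature) : Set where
  field
    lhs rhs    : Term S
    lhs-nonvar : ¬ IsVar lhs
    rhs-vars   : ∀ {x} → x occursIn rhs → x occursIn lhs

open Rule public

TRS : Signature → Set
TRS S = List (Rule S)

module _ {S : Signature} where

  renamingBy : ℕ ↔ ℕ → Subst S
  renamingBy ρ x = var (Inverse.to ρ x)

  Variant : Rule S → Rule S → Set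
  Variant α β = ∃ λ ρ → lhs α · renamingBy ρ ≡ lhs β × rhs α · renamingBy ρ ≡ rhs β

  -- The variables of a rule are those of its left-hand side.
  VariableDisjoint : Rule S → Rule S → Set
  VariableDisjoint α β = ∀ {x} → x occursIn lhs α → ¬ x occursIn lhs β

module _ {S : Signature} (R : TRS S) where

  record Step (s t : Term S) : Set where
    field
      rule   : Rule S
      rule∈R : rule ∈ R
      pos    : Pos s
      subst  : Subst S
      redex  : s ∣ pos ≡ lhs rule · subst
      result : t ≡ s [ rhs rule · subst ]at pos

  Redex : Term S → Set
  Redex s = ∃ λ α → α ∈ R × ∃ λ σ → s ≡ lhs α · σ

  InnermostRedex : Term S → Set
  InnermostRedex s = Redex s × (∀ (π : Pos s) → π ≢ ε → ¬ Redex (s ∣ π))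

  InnermostStep : Term S → Term S → Set
  InnermostStep s t = Σ (Step s t) λ p → InnermostRedex (s ∣ Step.pos p)

  -- The two clauses are a case distinction on whether s is itself an innermost
  -- redex.  The negative premise of args is essential: "s rewrites to t in one
  -- or more innermost steps" does not by itself ensure that args contracts
  -- anything, because s may lie on a cycle.  For the rules a → b and b → a,
  -- which have no critical pairs, args without that premise would give a ⇒ a
  -- (there are no arguments, and a → b → a) in addition to a ⇒ b.
  data ParallelInnermost : Term S → Term S → Set where
    root : ∀ {s t} →
           TransClosure InnermostStep s t →
           InnermostRedex s →
           InnermostStep s t →
           ParallelInnermost s t
    args : ∀ {f ss ts} →
           TransClosure InnermostStep (fun f ss) (fun f ts) →
           ¬ InnermostRedex (fun f ss) →
           Pointwise (λ s t → ParallelInnermost s t ⊎ (s ≡ t × IsNormalForm Step s)) ss ts →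
           ParallelInnermost (fun f ss) (fun f ts)

  -- ℓ → r is inner and u → v is outer; both are variants of rules of R.
  record CriticalPeak : Set where
    field
      inner outer : Rule S
      inner∈R     : ∃ λ α → α ∈ R × Variant α inner
      outer∈R     : ∃ λ α → α ∈ R × Variant α outer
      apart       : VariableDisjoint inner outer
      pos         : Pos (lhs outer)
      pos-nonvar  : ¬ IsVar (lhs outer ∣ pos)
      pos-root    : pos ≡ ε → ¬ Variant inner outer
      mgu         : Subst S
      isMGU       : IsMGU mgu (lhs inner) (lhs outer ∣ pos)

    source left right : Term S
    source = lhs outer · mgu
    left   = source [ rhs inner · mgu ]at liftPos mgu pos
    right  = rhs outer · mgu

    IsOverlay : Set
    IsOverlay = pos ≡ ε

    IsInnermost : Set
    IsInnermost = InnermostStep source left × InnermostStep source right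

    IsTrivial : Set
    IsTrivial = left ≡ right

  InnermostOverlaysTrivial : Set
  InnermostOverlaysTrivial =
    ∀ (p : CriticalPeak) → let open CriticalPeak p in IsOverlay → IsInnermost → IsTrivial

{-# OPTIONS --safe #-}
-- Only the root case of determinism is not immediate: an innermost redex s
-- with s = ℓσ = uτ for rules ℓ → r and u → v.  After renaming u → v apart, σ
-- and τ merge into one unifier of ℓ and u.  Unless the rules are variants
-- (where rσ = vτ because ℓσ determines σ on the variables of r), ℓ and u have
-- a most general unifier μ, with s an instance of ℓμ.  A redex below the root
-- of ℓμ would give one in s, so the overlay rμ ⋈ vμ is innermost, hence
-- trivial, and therefore so is its instance rσ = vτ.  Being a variant need not
-- be decided, because equality of terms is decidable and hence stable under
-- double negation.
module Submission where

open import Defs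
open import Data.Fin.Properties using () renaming (_≟_ to _≟ᶠ_)
open import Data.List.Membership.Propositional using (_∈_)
open import Data.Nat using (ℕ; suc; _+_; _∸_; _⊔_; _≤_; _<_; z≤n; s≤s; s≤s⁻¹)
open import Data.Nat.Properties renaming (_≟_ to _≟ℕ_)
open import Data.Product using (∃; _×_; _,_; proj₁; proj₂)
open import Data.Sum using (_⊎_; inj₁; inj₂)
open import Data.Vec using (Vec; []; _∷_; _++_)
open import Data.Vec.Properties using (∷-injective; ++-injective)
open import Data.Vec.Relation.Binary.Pointwise.Inductive using (Pointwise; []; _∷_)
open import Data.Vec.Relation.Unary.Any using (Any; here; there)
open import Function.Base using (_∘_)
open import Function.Bundles using (_↔_; mk↔ₛ′; Inverse)
open import Function.Construct.Identity using (↔-id)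
open import Relation.Binary.Construct.Closure.Transitive using ([_]; _∷_)
open import Relation.Binary.Definitions using (DecidableEquality)
open import Relation.Binary.PropositionalEquality
open import Relation.Binary.Rewriting using (Deterministic; Confluent; IsNormalForm; det⇒conf)
open import Relation.Nullary using (¬_; Dec; yes; no; contradiction)
open import Relation.Nullary.Decidable using (decidable-stable; map′)

-- A bijective renaming that moves a block of variables away

-- Renamings are bijections of `ℕ`, and the shift by `N` is not surjective. Exchanging `[0, N)` with
-- `[N, 2N)` is bijective, and its own inverse.
swapBlocks : ℕ → ℕ → ℕ
swapBlocks N x with x <? N | x <? N + N
... | yes _ | _     = N + x
... | no _  | yes _ = x ∸ N
... | no _  | no _  = x

module _ {N : ℕ} where

  swapBlocks-low : ∀ {x} → x < N → swapBlocks N x ≡ N + x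
  swapBlocks-low {x} x<N with x <? N | x <? N + N
  ... | yes _  | _ = refl
  ... | no x≮N | _ = contradiction x<N x≮N

  swapBlocks-mid : ∀ {x} → x < N → swapBlocks N (N + x) ≡ x
  swapBlocks-mid {x} x<N with N + x <? N | N + x <? N + N
  ... | yes N+x<N | _      = contradiction N+x<N (m+n≮m N x)
  ... | no _      | yes _  = m+n∸m≡n N x
  ... | no _      | no ≮2N = contradiction (+-monoʳ-< N x<N) ≮2N

  swapBlocks-high : ∀ {x} → N + N ≤ x → swapBlocks N x ≡ x
  swapBlocks-high {x} 2N≤x with x <? N | x <? N + N
  ... | yes x<N | _        = contradiction (≤-trans (m≤m+n N N) 2N≤x) (<⇒≱ x<N)
  ... | no _    | yes x<2N = contradiction 2N≤x (<⇒≱ x<2N)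
  ... | no _    | no _     = refl

  swapBlocks-involutive : ∀ x → swapBlocks N (swapBlocks N x) ≡ x
  swapBlocks-involutive x with x <? N | x <? N + N
  ... | yes x<N | _        = swapBlocks-mid x<N
  ... | no _    | no x≮2N  = swapBlocks-high (≮⇒≥ x≮2N)
  ... | no x≮N  | yes x<2N =
    trans (swapBlocks-low (+-cancelˡ-< N _ _ (subst (_< N + N) (sym N+[x∸N]≡x) x<2N))) N+[x∸N]≡x
    where
    N+[x∸N]≡x : N + (x ∸ N) ≡ x
    N+[x∸N]≡x = m+[n∸m]≡n (≮⇒≥ x≮N)

swapBlocks-↔ : ℕ → ℕ ↔ ℕ
swapBlocks-↔ N = mk↔ₛ′ (swapBlocks N) (swapBlocks N) (swapBlocks-involutive {N}) (swapBlocks-involutive {N})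

-- Decidable equality and the variables of a term

module _ {S : Signature} where

  var-injective : ∀ {x y} → var {S} x ≡ var y → x ≡ y
  var-injective refl = refl

  fun-injective : ∀ {f ts us} → fun {S} f ts ≡ fun f us → ts ≡ us
  fun-injective refl = refl

  fun-symbol-injective : ∀ {f g ts us} → fun {S} f ts ≡ fun g us → f ≡ g
  fun-symbol-injective refl = refl

  infix 4 _≟_ _≟ₐ_

  mutual
    _≟_ : DecidableEquality (Term S)
    var x    ≟ var y    = map′ (cong var) var-injective (x ≟ℕ y)
    var _    ≟ fun _ _  = no λ ()
    fun _ _  ≟ var _    = no λ ()
    fun f ts ≟ fun g us with f ≟ᶠ g
    ... | yes refl = map′ (cong (fun f)) fun-injective (ts ≟ₐ us)
    ... | no f≢g   = no (f≢g ∘ fun-symbol-injective)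

    _≟ₐ_ : ∀ {n} → DecidableEquality (Vec (Term S) n)
    []       ≟ₐ []       = yes refl
    (t ∷ ts) ≟ₐ (u ∷ us) with t ≟ u | ts ≟ₐ us
    ... | yes refl | yes refl = yes refl
    ... | no t≢u   | _        = no λ { refl → t≢u refl }
    ... | yes _    | no ts≢us = no λ { refl → ts≢us refl }

  mutual
    _occursIn?_ : ∀ x (t : Term S) → Dec (x occursIn t)
    x occursIn? var y    = map′ (λ { refl → here }) (λ { here → refl }) (x ≟ℕ y)
    x occursIn? fun f ts = map′ arg (λ { (arg o) → o }) (x occursInₐ? ts)

    _occursInₐ?_ : ∀ x {n} (ts : Vec (Term S) n) → Dec (Any (x occursIn_) ts)
    x occursInₐ? []       = no λ ()
    x occursInₐ? (t ∷ ts) with x occursIn? t | x occursInₐ? ts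
    ... | yes o | _      = yes (here o)
    ... | no _  | yes o  = yes (there o)
    ... | no ∉t | no ∉ts = no λ { (here o) → ∉t o ; (there o) → ∉ts o }

  mutual
    variableBound : Term S → ℕ
    variableBound (var x)    = suc x
    variableBound (fun f ts) = variableBoundₐ ts

    variableBoundₐ : ∀ {n} → Vec (Term S) n → ℕ
    variableBoundₐ []       = 0
    variableBoundₐ (t ∷ ts) = variableBound t ⊔ variableBoundₐ ts

  mutual
    occursIn⇒<variableBound : ∀ {x t} → x occursIn t → x < variableBound t
    occursIn⇒<variableBound here    = ≤-refl
    occursIn⇒<variableBound (arg o) = occursInₐ⇒<variableBoundₐ o

    occursInₐ⇒<variableBoundₐ : ∀ {x n} {ts : Vec (Term S) n} →
                                Any (x occursIn_) ts → x < variableBoundₐ ts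
    occursInₐ⇒<variableBoundₐ (here o)  = m≤n⇒m≤n⊔o _ (occursIn⇒<variableBound o)
    occursInₐ⇒<variableBoundₐ (there o) = m≤n⇒m≤o⊔n _ (occursInₐ⇒<variableBoundₐ o)

  -- Agreement and composition of substitutions

  mutual
    ·-cong : ∀ {σ τ} (t : Term S) → (∀ {x} → x occursIn t → σ x ≡ τ x) → t · σ ≡ t · τ
    ·-cong (var x)    σ≗τ = σ≗τ here
    ·-cong (fun f ts) σ≗τ = cong (fun f) (·ₐ-cong ts (σ≗τ ∘ arg))

    ·ₐ-cong : ∀ {σ τ n} (ts : Vec (Term S) n) →
              (∀ {x} → Any (x occursIn_) ts → σ x ≡ τ x) → ts ·ₐ σ ≡ ts ·ₐ τ
    ·ₐ-cong []       σ≗τ = refl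
    ·ₐ-cong (t ∷ ts) σ≗τ = cong₂ _∷_ (·-cong t (σ≗τ ∘ here)) (·ₐ-cong ts (σ≗τ ∘ there))

  mutual
    -- The value at `x` can be read off from the instance at any occurrence of `x`.
    ·-cong⁻¹ : ∀ {σ τ x} {t : Term S} → t · σ ≡ t · τ → x occursIn t → σ x ≡ τ x
    ·-cong⁻¹ eq here    = eq
    ·-cong⁻¹ eq (arg o) = ·ₐ-cong⁻¹ (fun-injective eq) o

    ·ₐ-cong⁻¹ : ∀ {σ τ x n} {ts : Vec (Term S) n} →
                ts ·ₐ σ ≡ ts ·ₐ τ → Any (x occursIn_) ts → σ x ≡ τ x
    ·ₐ-cong⁻¹ eq (here o)  = ·-cong⁻¹ (proj₁ (∷-injective eq)) o
    ·ₐ-cong⁻¹ eq (there o) = ·ₐ-cong⁻¹ (proj₂ (∷-injective eq)) o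

  mutual
    ·-identity : ∀ (t : Term S) → t · var ≡ t
    ·-identity (var x)    = refl
    ·-identity (fun f ts) = cong (fun f) (·ₐ-identity ts)

    ·ₐ-identity : ∀ {n} (ts : Vec (Term S) n) → ts ·ₐ var ≡ ts
    ·ₐ-identity []       = refl
    ·ₐ-identity (t ∷ ts) = cong₂ _∷_ (·-identity t) (·ₐ-identity ts)

  infixl 9 _⨟_

  _⨟_ : Subst S → Subst S → Subst S
  (σ ⨟ τ) x = σ x · τ

  mutual
    ·-⨟ : ∀ {σ τ} (t : Term S) → t · (σ ⨟ τ) ≡ t · σ · τ
    ·-⨟ (var x)    = refl
    ·-⨟ (fun f ts) = cong (fun f) (·ₐ-⨟ ts)

    ·ₐ-⨟ : ∀ {σ τ n} (ts : Vec (Term S) n) → ts ·ₐ (σ ⨟ τ) ≡ ts ·ₐ σ ·ₐ τ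
    ·ₐ-⨟ []       = refl
    ·ₐ-⨟ (t ∷ ts) = cong₂ _∷_ (·-⨟ t) (·ₐ-⨟ ts)

  ·ₐ-++ : ∀ {σ m n} (ss : Vec (Term S) m) {ts : Vec (Term S) n} →
          (ss ++ ts) ·ₐ σ ≡ (ss ·ₐ σ) ++ (ts ·ₐ σ)
  ·ₐ-++ []       = refl
  ·ₐ-++ (s ∷ ss) = cong (_ ∷_) (·ₐ-++ ss)

  -- Term size and the occurs check

  mutual
    termSize : Term S → ℕ
    termSize (var x)    = 1
    termSize (fun f ts) = suc (termSizeₐ ts)

    termSizeₐ : ∀ {n} → Vec (Term S) n → ℕ
    termSizeₐ []       = 0
    termSizeₐ (t ∷ ts) = termSize t + termSizeₐ ts

  termSize>0 : ∀ t → 0 < termSize t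
  termSize>0 (var x)    = ≤-refl
  termSize>0 (fun f ts) = s≤s z≤n

  termSizeₐ-++ : ∀ {m n} (ss : Vec (Term S) m) {ts : Vec (Term S) n} →
             termSizeₐ (ss ++ ts) ≡ termSizeₐ ss + termSizeₐ ts
  termSizeₐ-++ []       = refl
  termSizeₐ-++ (s ∷ ss) = trans (cong (termSize s +_) (termSizeₐ-++ ss)) (sym (+-assoc (termSize s) _ _))

  mutual
    termSize-occursIn : ∀ {σ x} {t : Term S} → x occursIn t → termSize (σ x) ≤ termSize (t · σ)
    termSize-occursIn here    = ≤-refl
    termSize-occursIn (arg o) = m≤n⇒m≤1+n (termSize-occursInₐ o)

    termSize-occursInₐ : ∀ {σ x n} {ts : Vec (Term S) n} →
                     Any (x occursIn_) ts → termSize (σ x) ≤ termSizeₐ (ts ·ₐ σ)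
    termSize-occursInₐ (here o)  = m≤n⇒m≤n+o _ (termSize-occursIn o)
    termSize-occursInₐ (there o) = m≤n⇒m≤o+n _ (termSize-occursInₐ o)

  -- Here `x` lies strictly inside `t`, so `t · σ` is strictly larger than `σ x`.
  occurs-check : ∀ {σ x t} → x occursIn t → t ≢ var x → σ x ≢ t · σ
  occurs-check here    t≢x _  = t≢x refl
  occurs-check (arg o) _   eq = <-irrefl (cong termSize eq) (s≤s (termSize-occursInₐ o))

  -- Existence of most general unifiers

  Unifiesₐ : ∀ {n} → Subst S → Vec (Term S) n → Vec (Term S) n → Set
  Unifiesₐ σ ss ts = ss ·ₐ σ ≡ ts ·ₐ σ

  IsMGUₐ : ∀ {n} → Subst S → Vec (Term S) n → Vec (Term S) n → Set
  IsMGUₐ σ ss ts =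
    Unifiesₐ σ ss ts ×
    (∀ τ → Unifiesₐ τ ss ts → ∃ λ (δ : Subst S) → ∀ x → τ x ≡ σ x · δ)

  -- Most general unifiers depend only on the set of unifiers. This justifies deleting, orienting
  -- and decomposing equations.
  IsMGUₐ-resp : ∀ {m n σ} {ss ts : Vec (Term S) m} {ss′ ts′ : Vec (Term S) n} →
                (∀ {τ} → Unifiesₐ τ ss ts → Unifiesₐ τ ss′ ts′) →
                (∀ {τ} → Unifiesₐ τ ss′ ts′ → Unifiesₐ τ ss ts) →
                IsMGUₐ σ ss ts → IsMGUₐ σ ss′ ts′
  IsMGUₐ-resp to from (unifies , general) = to unifies , λ τ → general τ ∘ from

  _↦_ : ℕ → Term S → Subst S
  (x ↦ t) y with y ≟ℕ x
  ... | yes _ = t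
  ... | no _  = var y

  ↦-same : ∀ x t → (x ↦ t) x ≡ t
  ↦-same x t with x ≟ℕ x
  ... | yes _  = refl
  ... | no x≢x = contradiction refl x≢x

  ↦-fresh : ∀ {x t} u → ¬ x occursIn u → u · (x ↦ t) ≡ u
  ↦-fresh {x} {t} u x∉u = trans (·-cong u agree) (·-identity u)
    where
    agree : ∀ {y} → y occursIn u → (x ↦ t) y ≡ var y
    agree {y} y∈u with y ≟ℕ x
    ... | yes refl = contradiction y∈u x∉u
    ... | no _     = refl

  -- A substitution that already identifies `x` with `t` is unaffected by replacing `x` with `t`
  -- first.
  ↦-absorb : ∀ {x t τ} → τ x ≡ t · τ → ∀ y → τ y ≡ ((x ↦ t) ⨟ τ) y
  ↦-absorb {x} τx≡tτ y with y ≟ℕ x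
  ... | yes refl = τx≡tτ
  ... | no _     = refl

  ↦-absorbₐ : ∀ {x t τ} → τ x ≡ t · τ →
              ∀ {n} (ts : Vec (Term S) n) → ts ·ₐ (x ↦ t) ·ₐ τ ≡ ts ·ₐ τ
  ↦-absorbₐ τx≡tτ ts = trans (sym (·ₐ-⨟ ts)) (sym (·ₐ-cong ts λ {y} _ → ↦-absorb τx≡tτ y))

  Unifiesₐ-↦ : ∀ {x t τ n} {ss ts : Vec (Term S) n} →
               τ x ≡ t · τ → Unifiesₐ τ ss ts → Unifiesₐ τ (ss ·ₐ (x ↦ t)) (ts ·ₐ (x ↦ t))
  Unifiesₐ-↦ {ss = ss} {ts} τx≡tτ eq =
    trans (↦-absorbₐ τx≡tτ ss) (trans eq (sym (↦-absorbₐ τx≡tτ ts)))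

  -- Variable elimination. As `x` is not in `t`, the binding leaves `t` fixed and so solves the
  -- first equation; generality follows by absorption.
  IsMGUₐ-↦ : ∀ {x t σ n} {ss ts : Vec (Term S) n} → ¬ x occursIn t →
             IsMGUₐ σ (ss ·ₐ (x ↦ t)) (ts ·ₐ (x ↦ t)) →
             IsMGUₐ ((x ↦ t) ⨟ σ) (var x ∷ ss) (t ∷ ts)
  IsMGUₐ-↦ {x} {t} {σ} {ss = ss} {ts} x∉t (unifies , general) =
    cong₂ _∷_
      (trans (cong (_· σ) (trans (↦-same x t) (sym (↦-fresh t x∉t)))) (sym (·-⨟ t)))
      (trans (·ₐ-⨟ ss) (trans unifies (sym (·ₐ-⨟ ts)))) ,
    general′
    where
    general′ : ∀ τ → Unifiesₐ τ (var x ∷ ss) (t ∷ ts) →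
               ∃ λ (δ : Subst S) → ∀ y → τ y ≡ ((x ↦ t) ⨟ σ) y · δ
    general′ τ eq with ∷-injective eq
    ... | τx≡tτ , eqs with general τ (Unifiesₐ-↦ τx≡tτ eqs)
    ... | δ , τ≗σδ = δ , λ y →
      trans (↦-absorb τx≡tτ y)
            (trans (·-cong ((x ↦ t) y) λ {z} _ → τ≗σδ z) (·-⨟ ((x ↦ t) y)))

  -- The termSize of the common instance ss ·ₐ τ bounds the recursion: unlike the
  -- equations themselves, it does not grow when a variable is eliminated.
  MGUsBelow : ℕ → Set
  MGUsBelow k = ∀ {n} (ss ts : Vec (Term S) n) {τ} →
                Unifiesₐ τ ss ts → termSizeₐ (ss ·ₐ τ) < k → ∃ λ σ → IsMGUₐ σ ss ts

  -- Separate from `mgusBelow` so as to serve both orientations of the equation. Removing it lowers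
  -- the size by that of `τ x`, which is positive.
  mgu-var : ∀ {k} → MGUsBelow k → ∀ {n} x t (ss ts : Vec (Term S) n) {τ} →
            Unifiesₐ τ (var x ∷ ss) (t ∷ ts) → termSizeₐ ((var x ∷ ss) ·ₐ τ) ≤ k →
            ∃ λ σ → IsMGUₐ σ (var x ∷ ss) (t ∷ ts)
  mgu-var below x t ss ts {τ} eq ≤k with ∷-injective eq
  ... | τx≡tτ , eqs with t ≟ var x
  ... | yes refl =
    let σ , σ-mgu = below ss ts eqs (≤-trans (+-monoˡ-≤ _ (termSize>0 (τ x))) ≤k)
    in σ , IsMGUₐ-resp (cong (_ ∷_)) (proj₂ ∘ ∷-injective) σ-mgu
  ... | no t≢x with x occursIn? t
  ...   | yes x∈t = contradiction τx≡tτ (occurs-check {σ = τ} x∈t t≢x)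
  ...   | no x∉t =
    let σ , σ-mgu = below (ss ·ₐ (x ↦ t)) (ts ·ₐ (x ↦ t)) (Unifiesₐ-↦ τx≡tτ eqs)
                      -- Elimination may enlarge `ss`, but by absorption its instance under `τ`
                      -- stays the same.
                      (subst (λ us → termSizeₐ us < _) (sym (↦-absorbₐ τx≡tτ ss))
                        (≤-trans (+-monoˡ-≤ _ (termSize>0 (τ x))) ≤k))
    in (x ↦ t) ⨟ σ , IsMGUₐ-↦ x∉t σ-mgu

  Unifiesₐ-decompose : ∀ {f τ n} ss ts {ss′ ts′ : Vec (Term S) n} →
                       Unifiesₐ τ (fun f ss ∷ ss′) (fun f ts ∷ ts′) →
                       Unifiesₐ τ (ss ++ ss′) (ts ++ ts′)
  Unifiesₐ-decompose ss ts eq =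
    trans (·ₐ-++ ss)
      (trans (cong₂ _++_ (fun-injective (proj₁ (∷-injective eq))) (proj₂ (∷-injective eq)))
             (sym (·ₐ-++ ts)))

  Unifiesₐ-compose : ∀ {f τ n} ss ts {ss′ ts′ : Vec (Term S) n} →
                     Unifiesₐ τ (ss ++ ss′) (ts ++ ts′) →
                     Unifiesₐ τ (fun f ss ∷ ss′) (fun f ts ∷ ts′)
  Unifiesₐ-compose {τ = τ} ss ts eq =
    let eqˡ , eqʳ = ++-injective (ss ·ₐ τ) (ts ·ₐ τ)
                      (trans (sym (·ₐ-++ ss)) (trans eq (·ₐ-++ ts)))
    in cong₂ _∷_ (cong (fun _) eqˡ) eqʳ

  -- Unification by deletion, elimination, orientation and decomposition, by induction on `k`; no
  -- size lies below 0.
  mgusBelow : ∀ k → MGUsBelow k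
  mgusBelow (suc k) [] [] _ _ = var , refl , λ τ _ → τ , λ _ → refl
  mgusBelow (suc k) (var x ∷ ss) (t ∷ ts) eq <k =
    mgu-var (mgusBelow k) x t ss ts eq (s≤s⁻¹ <k)
  mgusBelow (suc k) (s@(fun _ _) ∷ ss) (var x ∷ ts) eq <k =
    let σ , σ-mgu = mgu-var (mgusBelow k) x s ts ss (sym eq)
                      -- The bound concerns the left-hand sides; after the swap it carries over
                      -- because both sides have the same instance.
                      (subst (λ us → termSizeₐ us ≤ k) eq (s≤s⁻¹ <k))
    in σ , IsMGUₐ-resp {ss = var x ∷ ts} {s ∷ ss} {s ∷ ss} sym sym σ-mgu
  mgusBelow (suc k) (fun f ss ∷ ss′) (fun g ts ∷ ts′) {τ} eq <k
    -- The common instance under `τ` rules out a symbol clash.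
    with fun-symbol-injective (proj₁ (∷-injective eq))
  ... | refl =
    let σ , σ-mgu = mgusBelow k (ss ++ ss′) (ts ++ ts′) (Unifiesₐ-decompose ss ts eq)
                      -- Dropping the symbol `f` makes the instance smaller by exactly one.
                      (subst (_< k) (sym (trans (cong termSizeₐ (·ₐ-++ ss)) (termSizeₐ-++ (ss ·ₐ τ))))
                        (s≤s⁻¹ <k))
    in σ , IsMGUₐ-resp {ss = ss ++ ss′} {ts ++ ts′} {fun f ss ∷ ss′} {fun f ts ∷ ts′}
           (Unifiesₐ-compose ss ts) (Unifiesₐ-decompose ss ts) σ-mgu

  unifiable⇒mgu : ∀ s t {τ} → Unifies {S} τ s t → ∃ λ σ → IsMGU σ s t
  unifiable⇒mgu s t eq =
    -- The bound is one more than the size of the instance given by the known unifier.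
    let σ , unifies , general = mgusBelow _ (s ∷ []) (t ∷ []) (cong (_∷ []) eq) ≤-refl
    in σ , proj₁ (∷-injective unifies) , λ τ → general τ ∘ cong (_∷ [])

  -- Positions under substitution

  mutual
    ∣-liftPos : ∀ {σ} {t : Term S} (π : Pos t) → (t · σ) ∣ liftPos σ π ≡ (t ∣ π) · σ
    ∣-liftPos ε       = refl
    ∣-liftPos (arg π) = ∣ₐ-liftPosₐ π

    ∣ₐ-liftPosₐ : ∀ {σ n} {ts : Vec (Term S) n} (π : Any Pos ts) →
                  (ts ·ₐ σ) ∣ₐ liftPosₐ σ π ≡ (ts ∣ₐ π) · σ
    ∣ₐ-liftPosₐ (here π)  = ∣-liftPos π
    ∣ₐ-liftPosₐ (there π) = ∣ₐ-liftPosₐ π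

  liftPos-nonroot : ∀ {σ} {t : Term S} {π : Pos t} → π ≢ ε → liftPos σ π ≢ ε
  liftPos-nonroot {π = ε}     π≢ε _ = π≢ε refl
  liftPos-nonroot {π = arg _} _   ()

  -- Renamed rules and variants

  mutual
    occursIn-rename : ∀ ρ {x} {t : Term S} →
                      x occursIn t → Inverse.to ρ x occursIn (t · renamingBy ρ)
    occursIn-rename ρ here    = here
    occursIn-rename ρ (arg o) = arg (occursInₐ-rename ρ o)

    occursInₐ-rename : ∀ ρ {x n} {ts : Vec (Term S) n} → Any (x occursIn_) ts →
                       Any (Inverse.to ρ x occursIn_) (ts ·ₐ renamingBy ρ)
    occursInₐ-rename ρ (here o)  = here (occursIn-rename ρ o)
    occursInₐ-rename ρ (there o) = there (occursInₐ-rename ρ o)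

  mutual
    occursIn-rename⁻¹ : ∀ ρ {x} (t : Term S) → x occursIn (t · renamingBy ρ) →
                        ∃ λ y → y occursIn t × x ≡ Inverse.to ρ y
    occursIn-rename⁻¹ ρ (var y)    here    = y , here , refl
    occursIn-rename⁻¹ ρ (fun f ts) (arg o) =
      let y , y∈ts , eq = occursInₐ-rename⁻¹ ρ ts o in y , arg y∈ts , eq

    occursInₐ-rename⁻¹ : ∀ ρ {x n} (ts : Vec (Term S) n) →
                         Any (x occursIn_) (ts ·ₐ renamingBy ρ) →
                         ∃ λ y → Any (y occursIn_) ts × x ≡ Inverse.to ρ y
    occursInₐ-rename⁻¹ ρ (t ∷ ts) (here o) =
      let y , y∈t , eq = occursIn-rename⁻¹ ρ t o in y , here y∈t , eq
    occursInₐ-rename⁻¹ ρ (t ∷ ts) (there o) =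
      let y , y∈ts , eq = occursInₐ-rename⁻¹ ρ ts o in y , there y∈ts , eq

  isVar-rename⁻¹ : ∀ ρ (t : Term S) → IsVar (t · renamingBy ρ) → IsVar t
  isVar-rename⁻¹ ρ (var x) v = v

  renameRule : ℕ ↔ ℕ → Rule S → Rule S
  renameRule ρ α = record
    { lhs        = lhs α · renamingBy ρ
    ; rhs        = rhs α · renamingBy ρ
    ; lhs-nonvar = lhs-nonvar α ∘ isVar-rename⁻¹ ρ (lhs α)
    ; rhs-vars   = λ x∈rhs → let y , y∈rhs , eq = occursIn-rename⁻¹ ρ (rhs α) x∈rhs in
        subst (_occursIn _) (sym eq) (occursIn-rename ρ (rhs-vars α y∈rhs))
    }

  Variant-refl : ∀ (α : Rule S) → Variant α α
  Variant-refl α = ↔-id ℕ , ·-identity (lhs α) , ·-identity (rhs α)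

  -- The equal redexes force `σ` to agree with `renamingBy ρ ⨟ τ` on the variables of `lhs α`, which
  -- include those of `rhs α`.
  variant-contracta : ∀ {α β : Rule S} {σ τ} → Variant α β →
                      lhs α · σ ≡ lhs β · τ → rhs α · σ ≡ rhs β · τ
  variant-contracta {α} {β} {σ} {τ} (ρ , lhs-eq , rhs-eq) eq = begin
    rhs α · σ                    ≡⟨ ·-cong (rhs α) (·-cong⁻¹ lhs-agree ∘ rhs-vars α) ⟩
    rhs α · (renamingBy ρ ⨟ τ)   ≡⟨ ·-⨟ (rhs α) ⟩
    rhs α · renamingBy ρ · τ     ≡⟨ cong (_· τ) rhs-eq ⟩
    rhs β · τ                    ∎
    where
    open ≡-Reasoning
    lhs-agree : lhs α · σ ≡ lhs α · (renamingBy ρ ⨟ τ)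
    lhs-agree = trans eq (trans (cong (_· τ) (sym lhs-eq)) (sym (·-⨟ (lhs α))))

  -- Merging the substitutions of two rules renamed apart

  -- Acts as `σ` on terms with variables below `N`, and as `τ` on the renamed copies of such terms,
  -- whose variables start at `N`.
  mergeAt : ℕ → Subst S → Subst S → Subst S
  mergeAt N σ τ x with x <? N
  ... | yes _ = σ x
  ... | no _  = τ (swapBlocks N x)

  mergeAt-low : ∀ {N σ τ} (t : Term S) → variableBound t ≤ N → t · mergeAt N σ τ ≡ t · σ
  mergeAt-low {N} {σ} {τ} t bound≤N = ·-cong t agree
    where
    agree : ∀ {x} → x occursIn t → mergeAt N σ τ x ≡ σ x
    agree {x} x∈t with x <? N
    ... | yes _  = refl
    ... | no x≮N = contradiction (<-≤-trans (occursIn⇒<variableBound x∈t) bound≤N) x≮N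

  mergeAt-renamed : ∀ {N σ τ} (t : Term S) → variableBound t ≤ N →
                    t · renamingBy (swapBlocks-↔ N) · mergeAt N σ τ ≡ t · τ
  mergeAt-renamed {N} {σ} {τ} t bound≤N = trans (sym (·-⨟ t)) (·-cong t agree)
    where
    agree : ∀ {x} → x occursIn t → mergeAt N σ τ (swapBlocks N x) ≡ τ x
    agree {x} x∈t with swapBlocks N x <? N
    ... | no _     = cong τ (swapBlocks-involutive {N} x)
    ... | yes ρx<N = contradiction
      (subst (_< N) (swapBlocks-low (<-≤-trans (occursIn⇒<variableBound x∈t) bound≤N)) ρx<N)
      (m+n≮m N x)

  renamed-apart : ∀ {N} (α β : Rule S) →
                  variableBound (lhs α) ≤ N → variableBound (lhs β) ≤ N →
                  VariableDisjoint α (renameRule (swapBlocks-↔ N) β)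
  renamed-apart {N} α β α≤N β≤N x∈α x∈β′ with occursIn-rename⁻¹ (swapBlocks-↔ N) (lhs β) x∈β′
  ... | y , y∈β , refl = m+n≮m N y
    (subst (_< N) (swapBlocks-low (<-≤-trans (occursIn⇒<variableBound y∈β) β≤N))
      (<-≤-trans (occursIn⇒<variableBound x∈α) α≤N))

-- Redexes and innermost steps

module _ {S : Signature} (R : TRS S) where

  Redex-· : ∀ {t σ} → Redex R t → Redex R (t · σ)
  Redex-· {σ = σ} (α , α∈R , τ , eq) =
    α , α∈R , τ ⨟ σ , trans (cong (_· σ) eq) (sym (·-⨟ (lhs α)))

  -- Redexes below the root persist under substitution. Being a redex at the root does not pass from
  -- an instance back to `t`, hence the first premise.
  InnermostRedex-·⁻¹ : ∀ {t σ} → Redex R t → InnermostRedex R (t · σ) → InnermostRedex R t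
  InnermostRedex-·⁻¹ {t} {σ} redex (_ , innermost) = redex , λ π π≢ε redex-π →
    innermost (liftPos σ π) (liftPos-nonroot π≢ε)
      (subst (Redex R) (sym (∣-liftPos π)) (Redex-· redex-π))

  -- A step below the root would contract a proper subterm, which cannot be a redex.
  innermostStep-root : ∀ {s t} → InnermostRedex R s → InnermostStep R s t →
                       ∃ λ α → α ∈ R × ∃ λ σ → s ≡ lhs α · σ × t ≡ rhs α · σ
  innermostStep-root (_ , innermost) (step , redex , _)
    with Step.pos step | Step.redex step | Step.result step
  ... | ε     | eq | eq′ = Step.rule step , Step.rule∈R step , Step.subst step , eq , eq′
  ... | arg π | eq | _   = contradiction
    (Step.rule step , Step.rule∈R step , Step.subst step , eq) (innermost (arg π) λ ())

  rootStep : ∀ {s t α σ} → α ∈ R → s ≡ lhs α · σ → t ≡ rhs α · σ → Step R s t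
  rootStep {α = α} {σ} α∈R s≡ t≡ = record
    { rule = α ; rule∈R = α∈R ; pos = ε ; subst = σ ; redex = s≡ ; result = t≡ }

  -- For `args` the step comes from the transitive closure; the arguments might all be normal forms.
  parallelInnermost⇒step : ∀ {s t} → ParallelInnermost R s t → ∃ (Step R s)
  parallelInnermost⇒step (root _ _ (step , _)) = _ , step
  parallelInnermost⇒step (args (step ∷ _) _ _) = _ , proj₁ step
  parallelInnermost⇒step (args [ step ] _ _)   = _ , proj₁ step

  -- Determinism and confluence

  module _ (trivial : InnermostOverlaysTrivial R) where

    root-contracta : ∀ {α β σ τ} → α ∈ R → β ∈ R →
                     lhs α · σ ≡ lhs β · τ → InnermostRedex R (lhs α · σ) →
                     rhs α · σ ≡ rhs β · τ
    root-contracta {α} {β} {σ} {τ} α∈R β∈R eq innermost = begin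
      rhs α · σ   ≡⟨ mergeAt-low (rhs α) rhsα≤N ⟨
      rhs α · θ   ≡⟨ decidable-stable (rhs α · θ ≟ rhs β′ · θ) contracta-¬¬ ⟩
      rhs β′ · θ  ≡⟨ mergeAt-renamed (rhs β) rhsβ≤N ⟩
      rhs β · τ   ∎
      where
      open ≡-Reasoning

      ruleBound : Rule S → ℕ
      ruleBound γ = variableBound (lhs γ) ⊔ variableBound (rhs γ)

      -- Large enough for both sides of both rules, so that the merged substitution acts correctly
      -- on all four terms.
      N = ruleBound α ⊔ ruleBound β

      lhsα≤N : variableBound (lhs α) ≤ N
      lhsα≤N = m≤n⇒m≤n⊔o _ (m≤m⊔n _ _)
      rhsα≤N : variableBound (rhs α) ≤ N
      rhsα≤N = m≤n⇒m≤n⊔o _ (m≤n⊔m (variableBound (lhs α)) _)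
      lhsβ≤N : variableBound (lhs β) ≤ N
      lhsβ≤N = m≤n⇒m≤o⊔n (ruleBound α) (m≤m⊔n _ _)
      rhsβ≤N : variableBound (rhs β) ≤ N
      rhsβ≤N = m≤n⇒m≤o⊔n (ruleBound α) (m≤n⊔m (variableBound (lhs β)) _)

      ρ  = swapBlocks-↔ N
      β′ = renameRule ρ β
      θ  = mergeAt N σ τ

      αθ≡ασ : lhs α · θ ≡ lhs α · σ
      αθ≡ασ = mergeAt-low (lhs α) lhsα≤N

      θ-unifies : Unifies θ (lhs α) (lhs β′)
      θ-unifies = trans αθ≡ασ (trans eq (sym (mergeAt-renamed (lhs β) lhsβ≤N)))

      contracta-¬¬ : ¬ ¬ (rhs α · θ ≡ rhs β′ · θ)
      contracta-¬¬ distinct with unifiable⇒mgu (lhs α) (lhs β′) θ-unifies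
      ... | μ , μ-unifies , μ-general with μ-general θ θ-unifies
      ... | δ , θ≗μδ = distinct (begin
        rhs α · θ        ≡⟨ factor (rhs α) ⟩
        -- At the root position, `left` of the peak computes to `rhs α · μ`.
        rhs α · μ · δ    ≡⟨ cong (_· δ) (trivial peak refl
                                        ((stepˡ , innermost-μ) , (stepʳ , innermost-μ))) ⟩
        rhs β′ · μ · δ   ≡⟨ factor (rhs β′) ⟨
        rhs β′ · θ       ∎)
        where
        factor : ∀ t → t · θ ≡ t · μ · δ
        factor t = trans (·-cong t λ {x} _ → θ≗μδ x) (·-⨟ t)

        peak : CriticalPeak R
        peak = record
          { inner      = α
          ; outer      = β′
          ; inner∈R    = α , α∈R , Variant-refl α
          ; outer∈R    = β , β∈R , ρ , refl , refl
          ; apart      = renamed-apart α β lhsα≤N lhsβ≤N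
          ; pos        = ε
          ; pos-nonvar = lhs-nonvar β′
          -- Variants would have equal contracta, so assuming `distinct` supplies the side condition
          -- on root peaks.
          ; pos-root   = λ _ variant → distinct (variant-contracta {α = α} {β′} variant θ-unifies)
          ; mgu        = μ
          ; isMGU      = μ-unifies , μ-general
          }

        stepˡ : Step R (lhs β′ · μ) (rhs α · μ)
        stepˡ = rootStep α∈R (sym μ-unifies) refl

        stepʳ : Step R (lhs β′ · μ) (rhs β′ · μ)
        -- Steps use rules of `R` itself, so `β` is applied with the renaming absorbed into the
        -- substitution.
        stepʳ = rootStep β∈R (sym (·-⨟ (lhs β))) (sym (·-⨟ (rhs β)))

        innermost-μ : InnermostRedex R (lhs β′ · μ)
        -- The given innermost redex `lhs α · σ` equals `lhs β′ · μ · δ`, an instance of the source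
        -- of the peak.
        innermost-μ = InnermostRedex-·⁻¹ (α , α∈R , μ , sym μ-unifies)
          (subst (InnermostRedex R) (trans (sym αθ≡ασ) (trans θ-unifies (factor (lhs β′)))) innermost)

    mutual
      -- Induction on the derivations; the negative premise of `args` excludes the mixed cases.
      parallelInnermost-deterministic : Deterministic _≡_ (ParallelInnermost R)
      parallelInnermost-deterministic (root _ innermost s→t) (root _ _ s→u)
        with innermostStep-root innermost s→t | innermostStep-root innermost s→u
      ... | α , α∈R , σ , refl , refl | β , β∈R , τ , eq , refl =
        root-contracta α∈R β∈R eq innermost
      parallelInnermost-deterministic (root _ innermost _) (args _ ¬innermost _) =
        contradiction innermost ¬innermost
      parallelInnermost-deterministic (args _ ¬innermost _) (root _ innermost _) =
        contradiction innermost ¬innermost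
      parallelInnermost-deterministic (args _ _ ss⇒ts) (args _ _ ss⇒us) =
        cong (fun _) (arguments-deterministic ss⇒ts ss⇒us)

      arguments-deterministic :
        ∀ {n} {ss ts us : Vec (Term S) n} →
        let _⇒_ = λ s t → ParallelInnermost R s t ⊎ (s ≡ t × IsNormalForm (Step R) s) in
        Pointwise _⇒_ ss ts → Pointwise _⇒_ ss us → ts ≡ us
      arguments-deterministic [] [] = refl
      arguments-deterministic (s⇒t ∷ ss⇒ts) (s⇒u ∷ ss⇒us) =
        cong₂ _∷_ (argument-deterministic s⇒t s⇒u) (arguments-deterministic ss⇒ts ss⇒us)

      argument-deterministic :
        ∀ {s t u} →
        let _⇒_ = λ s t → ParallelInnermost R s t ⊎ (s ≡ t × IsNormalForm (Step R) s) in
        s ⇒ t → s ⇒ u → t ≡ u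
      argument-deterministic (inj₁ s⇒t)        (inj₁ s⇒u)        = parallelInnermost-deterministic s⇒t s⇒u
      -- A parallel step entails an ordinary step, impossible from a normal form.
      argument-deterministic (inj₁ s⇒t)        (inj₂ (_ , nf))   = contradiction (parallelInnermost⇒step s⇒t) nf
      argument-deterministic (inj₂ (_ , nf))   (inj₁ s⇒u)        = contradiction (parallelInnermost⇒step s⇒u) nf
      argument-deterministic (inj₂ (refl , _)) (inj₂ (refl , _)) = refl

theorem6p18 : (S : Signature) (R : TRS S) →
    InnermostOverlaysTrivial R →
    Deterministic _≡_ (ParallelInnermost R) × Confluent (ParallelInnermost R)
-- Under determinism, of two reductions from one term one extends the other, so they are joinable.
theorem6p18 S R trivial = deterministic , det⇒conf deterministic
  where deterministic = parallelInnermost-deterministic R trivial
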